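{- Let $\mathfrak{C}_{12}$ be the graph with vertex set $\{0,1,\dots,11\}$ in which $\{u,v\}$ is an edge iff $|u-v|\in\{1,3,9,11\}$, regarded as a bipartite graph with parts the even vertices and the odd vertices. Then $\mathfrak{C}_{12}$ is not constructible by conditioning.
   Context: A bipartite graph $(X,Y,E)$ with $E\subseteq X\times Y$ is viewed as a 2-partite hypergraph. A homomorphism $(X,Y,E)\to(X',Y',E')$ is a pair of maps $X\to X'$, $Y\to Y'$ mapping edges to edges. For $X_0\subseteq X,Y_0\subseteq Y$ the induced subgraph is $(X_0,Y_0,E\cap(X_0\times Y_0))$. Constructible by conditioning (recursively, up to renaming of vertices): (1) A single edge $(\{a\},\{b\},\{(a,b)\})$ is constructible. (2) Doubling: given a constructible graph whose vertices are partitioned into "fixed" and "old" vertices, add for every old vertex $q$ a fresh copy $q'$ on the same side, and for every edge $e$ not both of whose endpoints are fixed add the edge $e'$ obtained by replacing each old endpoint by its copy (keeping all previous edges); the result is constructible. (3) Collapse: if $H$ is constructible, $H_0$ is an induced subgraph of $H$, and some homomorphism $H\to H_0$ is the identity on the vertices of $H_0$, then $H_0$ is constructible. -}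

module Defs where

open import Data.Nat using (ℕ; _%_; ∣_-_∣)
open import Data.Fin using (Fin; toℕ)
open import Data.Bool using (Bool; true; false)
open import Data.Sum using (_⊎_; inj₁; inj₂)
open import Data.Product using (Σ; _×_; _,_; proj₁)
open import Data.Unit using (⊤)
open import Function.Bundles using (_↔_; _⇔_; Inverse)
open import Relation.Binary.PropositionalEquality using (_≡_)

record BipGraph : Set₁ where
  constructor bip
  field
    X : Set
    Y : Set
    E : X → Y → Set
open BipGraph public

record _≅_ (G H : BipGraph) : Set where
  field
    isoX : X G ↔ X H
    isoY : Y G ↔ Y H
    edges : ∀ x y → E G x y ⇔ E H (Inverse.to isoX x) (Inverse.to isoY y)

singleEdge : BipGraph
singleEdge = bip ⊤ ⊤ (λ _ _ → ⊤)

-- (2) doubling. oldX / oldY mark the "old" vertices (false = fixed).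
-- New vertices: a copy q' for every old vertex q.
-- For every edge e = (x,y) not both of whose endpoints are fixed, add e'
-- obtained by replacing each old endpoint by its copy.
double : (G : BipGraph) → (X G → Bool) → (Y G → Bool) → BipGraph
double G oldX oldY = bip X' Y' E'
  where
  X' : Set
  X' = X G ⊎ Σ (X G) (λ x → oldX x ≡ true)
  Y' : Set
  Y' = Y G ⊎ Σ (Y G) (λ y → oldY y ≡ true)
  E' : X' → Y' → Set
  E' (inj₁ x) (inj₁ y) = E G x y
  E' (inj₂ (x , _)) (inj₁ y) = E G x y × (oldY y ≡ false)
  E' (inj₁ x) (inj₂ (y , _)) = E G x y × (oldX x ≡ false)
  E' (inj₂ (x , _)) (inj₂ (y , _)) = E G x y

induced : (G : BipGraph) → (X G → Bool) → (Y G → Bool) → BipGraph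
induced G P Q =
  bip (Σ (X G) (λ x → P x ≡ true)) (Σ (Y G) (λ y → Q y ≡ true))
      (λ a b → E G (proj₁ a) (proj₁ b))

record Retraction (G : BipGraph) (P : X G → Bool) (Q : Y G → Bool) : Set where
  field
    f : X G → X (induced G P Q)
    g : Y G → Y (induced G P Q)
    hom : ∀ x y → E G x y → E (induced G P Q) (f x) (g y)
    idX : ∀ x → P x ≡ true → proj₁ (f x) ≡ x
    idY : ∀ y → Q y ≡ true → proj₁ (g y) ≡ y

data Constructible : BipGraph → Set₁ where
  edge     : Constructible singleEdge
  doubling : ∀ {G} (oldX : X G → Bool) (oldY : Y G → Bool) →
             Constructible G → Constructible (double G oldX oldY)
  collapse : ∀ {G} (P : X G → Bool) (Q : Y G → Bool) →
             Constructible G → Retraction G P Q → Constructible (induced G P Q)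
  rename   : ∀ {G H} → Constructible G → G ≅ H → Constructible H

goodDist : ℕ → Set
goodDist d = (d ≡ 1) ⊎ (d ≡ 3) ⊎ (d ≡ 9) ⊎ (d ≡ 11)

C12 : BipGraph
C12 = bip (Σ (Fin 12) (λ v → toℕ v % 2 ≡ 0))
          (Σ (Fin 12) (λ v → toℕ v % 2 ≡ 1))
          (λ u v → goodDist ∣ toℕ (proj₁ u) - toℕ (proj₁ v) ∣)

{-# OPTIONS --safe #-}

-- The invariant is that ℭ₁₂ is not a retract of G.  A single edge has it, and passing to a
-- retract preserves it.  For doubling, suppose ℭ₁₂ → double G → ℭ₁₂ composes to the identity.
-- Routing the second map through either of the two copies of G in double G gives
-- endomorphisms φ and χ of ℭ₁₂, both factoring through G, such that on every edge one
-- endpoint is fixed by φ or the other by χ.  This forces φ or χ to be the identity: the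
-- neighbours of a vertex moved by χ are fixed by φ, and an endomorphism fixing all neighbours
-- of an even and of an odd vertex either is the identity or moves all their non-neighbours.
-- So otherwise φ moves both non-neighbours of some odd q, and χ moves both non-neighbours of
-- one of these two; but one of the latter is adjacent to the other non-neighbour of q.
module Submission where

open import Defs
open import Axiom.UniquenessOfIdentityProofs using (module Decidable⇒UIP)
open import Data.Bool using (Bool; true; false)
open import Data.Bool.Properties using () renaming (_≟_ to _≟ᵇ_)
open import Data.Empty using (⊥-elim)
open import Data.Fin using (Fin; suc; toℕ; _≟_)
open import Data.Fin.Patterns
open import Data.Fin.Properties using (all?; ¬∀⟶∃¬)
open import Data.Nat as ℕ using (ℕ; _+_; ∣_-_∣)
open import Data.Nat.DivMod using (_mod_)
open import Data.Product using (Σ; _×_; _,_; proj₁; ∃)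
open import Data.Sum using (_⊎_; inj₁; inj₂; [_,_]′; fromInj₁; fromInj₂)
open import Function.Base using (_∘_; id)
open import Function.Bundles using (Inverse; Equivalence)
open import Relation.Binary.PropositionalEquality
  using (_≡_; _≢_; refl; sym; trans; cong; subst; subst₂)
open import Relation.Nullary using (¬_; Dec; yes; no; contradiction; ¬?)
open import Relation.Nullary.Decidable
  using (_×-dec_; _⊎-dec_; _→-dec_; toWitness)

-- Homomorphisms and retracts.

infix 4 _⟶_ _isRetractOf_
infixr 9 _⊙_

record _⟶_ (G H : BipGraph) : Set where
  constructor hom
  field
    onX  : X G → X H
    onY  : Y G → Y H
    onE  : ∀ {x y} → E G x y → E H (onX x) (onY y)
open _⟶_

_⊙_ : ∀ {G H L} → H ⟶ L → G ⟶ H → G ⟶ L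
g ⊙ f = hom (onX g ∘ onX f) (onY g ∘ onY f) (onE g ∘ onE f)

record IsIdentity {G} (φ : G ⟶ G) : Set where
  constructor isId
  field
    fixX : ∀ x → onX φ x ≡ x
    fixY : ∀ y → onY φ y ≡ y
open IsIdentity

record _isRetractOf_ (H G : BipGraph) : Set where
  constructor retract
  field
    section      : H ⟶ G
    retraction   : G ⟶ H
    retractionId : IsIdentity (retraction ⊙ section)

retract-trans : ∀ {G H L} → G isRetractOf H → H isRetractOf L → G isRetractOf L
retract-trans (retract i r (isId rx ry)) (retract j s (isId sx sy)) =
  retract (j ⊙ i) (r ⊙ s)
    (isId (λ x → trans (cong (onX r) (sx (onX i x))) (rx x))
          (λ y → trans (cong (onY r) (sy (onY i y))) (ry y)))

≅⇒retract : ∀ {G H} → G ≅ H → H isRetractOf G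
≅⇒retract {G} {H} iso = retract
  (hom (Inverse.from isoX) (Inverse.from isoY)
    (λ {x} {y} e → Equivalence.from (edges _ _)
      (subst₂ (E H) (sym (toFromX x)) (sym (toFromY y)) e)))
  (hom (Inverse.to isoX) (Inverse.to isoY) (Equivalence.to (edges _ _)))
  (isId toFromX toFromY)
  where
  open _≅_ iso
  toFromX : ∀ x → Inverse.to isoX (Inverse.from isoX x) ≡ x
  toFromX = Inverse.strictlyInverseˡ isoX
  toFromY : ∀ y → Inverse.to isoY (Inverse.from isoY y) ≡ y
  toFromY = Inverse.strictlyInverseˡ isoY

subset-≡ : ∀ {A : Set} {P : A → Bool} {a b : Σ A (λ x → P x ≡ true)} →
           proj₁ a ≡ proj₁ b → a ≡ b
subset-≡ {a = a , p} {b = .a , q} refl = cong (a ,_) (Decidable⇒UIP.≡-irrelevant _≟ᵇ_ p q)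

induced-retract : ∀ {G P Q} → Retraction G P Q → induced G P Q isRetractOf G
induced-retract r = retract
  (hom proj₁ proj₁ id)
  (hom f g (hom′ _ _))
  (isId (λ (x , p) → subset-≡ (idX x p)) (λ (y , q) → subset-≡ (idY y q)))
  where open Retraction r renaming (hom to hom′)

-- The two embeddings of a graph into its double.

module _ {A : Set} (old : A → Bool) where

  -- The pair of arguments (b , old x ≡ b) makes it possible to case split on old x.
  copyAt : ∀ x b → old x ≡ b → A ⊎ Σ A (λ x → old x ≡ true)
  copyAt x true  o = inj₂ (x , o)
  copyAt x false _ = inj₁ x

  copy : A → A ⊎ Σ A (λ x → old x ≡ true)
  copy x = copyAt x (old x) refl

  unfold : A ⊎ Σ A (λ x → old x ≡ true) → A
  unfold = [ id , proj₁ ]′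

  copyAt-unique : ∀ {x b c} (o : old x ≡ b) (o′ : old x ≡ c) → copyAt x b o ≡ copyAt x c o′
  copyAt-unique refl refl = refl

  copy-fixed : ∀ {x} → old x ≡ false → copy x ≡ inj₁ x
  copy-fixed o = copyAt-unique refl o

  copy-old : ∀ {x} (o : old x ≡ true) → copy x ≡ inj₂ (x , o)
  copy-old o = copyAt-unique refl o

module _ {G : BipGraph} (oldX : X G → Bool) (oldY : Y G → Bool) where

  private
    D : BipGraph
    D = double G oldX oldY

  original : G ⟶ D
  original = hom inj₁ inj₁ id

  -- The second embedding of `G`: old vertices go to their copies, fixed vertices are shared with
  -- `original`.
  copied : G ⟶ D
  copied = hom (copy oldX) (copy oldY) (λ {x} {y} → edge′ x y (oldX x) (oldY y) refl refl)
    where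
    edge′ : ∀ x y b c (o : oldX x ≡ b) (o′ : oldY y ≡ c) → E G x y →
            E D (copyAt oldX x b o) (copyAt oldY y c o′)
    edge′ x y true  true  o o′ e = e
    edge′ x y true  false o o′ e = e , o′
    edge′ x y false true  o o′ e = e , o
    edge′ x y false false o o′ e = e

  folding : D ⟶ G
  folding = hom (unfold oldX) (unfold oldY) (λ {x} {y} → edge′ x y)
    where
    edge′ : ∀ x y → E D x y → E G (unfold oldX x) (unfold oldY y)
    edge′ (inj₁ _) (inj₁ _) e       = e
    edge′ (inj₁ _) (inj₂ _) (e , _) = e
    edge′ (inj₂ _) (inj₁ _) (e , _) = e
    edge′ (inj₂ _) (inj₂ _) e       = e

  FixedX : (D ⟶ D) → X D → Set
  FixedX φ x = onX φ x ≡ x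

  FixedY : (D ⟶ D) → Y D → Set
  FixedY φ y = onY φ y ≡ y

  -- No edge of the double joins an old original to a copy. The map `copied ⊙ folding` moves only
  -- old originals and `original ⊙ folding` moves only copies, so they cannot move opposite ends of
  -- one edge.
  edge-fixedʳ : ∀ x y → E D x y →
                FixedX (copied ⊙ folding) x ⊎ FixedY (original ⊙ folding) y
  edge-fixedʳ (inj₂ (_ , o)) _        _       = inj₁ (copy-old oldX o)
  edge-fixedʳ (inj₁ _)       (inj₁ _) _       = inj₂ refl
  edge-fixedʳ (inj₁ _)       (inj₂ _) (_ , o) = inj₁ (copy-fixed oldX o)

  edge-fixedˡ : ∀ x y → E D x y →
                FixedX (original ⊙ folding) x ⊎ FixedY (copied ⊙ folding) y
  edge-fixedˡ (inj₁ _) _              _       = inj₁ refl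
  edge-fixedˡ (inj₂ _) (inj₂ (_ , o)) _       = inj₂ (copy-old oldY o)
  edge-fixedˡ (inj₂ _) (inj₁ _)       (_ , o) = inj₂ (copy-fixed oldY o)

-- The graph ℭ₁₂ and its non-adjacencies.

even : Fin 6 → X C12
even 0F = 0F , refl
even 1F = 2F , refl
even 2F = 4F , refl
even 3F = 6F , refl
even 4F = 8F , refl
even 5F = suc 9F , refl

odd : Fin 6 → Y C12
odd 0F = 1F , refl
odd 1F = 3F , refl
odd 2F = 5F , refl
odd 3F = 7F , refl
odd 4F = 9F , refl
odd 5F = suc (suc 9F) , refl

Adj : Fin 6 → Fin 6 → Set
Adj x y = E C12 (even x) (odd y)

adj? : ∀ x y → Dec (Adj x y)
adj? x y = (d ℕ.≟ 1) ⊎-dec (d ℕ.≟ 3) ⊎-dec (d ℕ.≟ 9) ⊎-dec (d ℕ.≟ 11)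
  where
  d : ℕ
  d = ∣ toℕ (proj₁ (even x)) - toℕ (proj₁ (odd y)) ∣

-- ℭ₁₂ with `x` standing for 2x and `y` for 2y+1, so that statements about all vertices can be
-- decided by enumeration.
K : BipGraph
K = bip (Fin 6) (Fin 6) Adj

K-retract-C12 : K isRetractOf C12
K-retract-C12 = retract
  (hom even odd id)
  (hom halfX halfY
    (λ {u} {v} e → subst₂ (E C12) (sym (even-half u)) (sym (odd-half v)) e))
  (isId (toWitness {a? = all? λ x → halfX (even x) ≟ x} _)
        (toWitness {a? = all? λ y → halfY (odd y) ≟ y} _))
  where
  half : Fin 12 → Fin 6
  -- The quotient is already below 6; `mod` only turns it into an element of `Fin 6`.
  half v = (toℕ v ℕ./ 2) mod 6
  halfX : X C12 → Fin 6
  halfX = half ∘ proj₁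
  halfY : Y C12 → Fin 6
  halfY = half ∘ proj₁
  even-half : ∀ u → even (halfX u) ≡ u
  even-half (0F , refl) = refl
  even-half (2F , refl) = refl
  even-half (4F , refl) = refl
  even-half (6F , refl) = refl
  even-half (8F , refl) = refl
  even-half (suc 9F , refl) = refl
  even-half (suc (suc 9F) , ())
  odd-half : ∀ v → odd (halfY v) ≡ v
  odd-half (1F , refl) = refl
  odd-half (3F , refl) = refl
  odd-half (5F , refl) = refl
  odd-half (7F , refl) = refl
  odd-half (9F , refl) = refl
  odd-half (suc (suc 9F) , refl) = refl

-- Non-neighbours in ℭ₁₂ lie at distance 5 or 7: those of 2x are 2x+5 and 2x+7, those of 2y+1 are
-- 2y+6 and 2y+8, modulo 12.
nonAdjY₁ nonAdjY₂ nonAdjX₁ nonAdjX₂ : Fin 6 → Fin 6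
nonAdjY₁ x = (toℕ x + 2) mod 6
nonAdjY₂ x = (toℕ x + 3) mod 6
nonAdjX₁ y = (toℕ y + 3) mod 6
nonAdjX₂ y = (toℕ y + 4) mod 6

splitY : ∀ x y → Adj x y ⊎ y ≡ nonAdjY₁ x ⊎ y ≡ nonAdjY₂ x
splitY = toWitness {a? = all? λ x → all? λ y →
  adj? x y ⊎-dec (y ≟ nonAdjY₁ x) ⊎-dec (y ≟ nonAdjY₂ x)} _

splitX : ∀ y x → Adj x y ⊎ x ≡ nonAdjX₁ y ⊎ x ≡ nonAdjX₂ y
splitX = toWitness {a? = all? λ y → all? λ x →
  adj? x y ⊎-dec (x ≟ nonAdjX₁ y) ⊎-dec (x ≟ nonAdjX₂ y)} _

-- All neighbourhoods have four elements, so an inclusion is an equality, and the pair of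
-- non-neighbours determines the vertex.
incomparableX : ∀ x x′ → (∀ y → Adj x y → Adj x′ y) → x′ ≡ x
incomparableX = toWitness {a? = all? λ x → all? λ x′ →
  (all? λ y → adj? x y →-dec adj? x′ y) →-dec (x′ ≟ x)} _

incomparableY : ∀ y y′ → (∀ x → Adj x y → Adj x y′) → y′ ≡ y
incomparableY = toWitness {a? = all? λ y → all? λ y′ →
  (all? λ x → adj? x y →-dec adj? x y′) →-dec (y′ ≟ y)} _

-- These are the vertices 2y+8 and 2y+11 modulo 12. Their edge yields the final contradiction
-- between the two endomorphisms.
nonAdjX₂-adj-nonAdjY₁ : ∀ y → Adj (nonAdjX₂ y) (nonAdjY₁ (nonAdjX₁ y))
nonAdjX₂-adj-nonAdjY₁ = toWitness {a? = all? λ y → adj? (nonAdjX₂ y) (nonAdjY₁ (nonAdjX₁ y))} _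

-- Endomorphisms of ℭ₁₂.

abstract
  -- Here a, b, c, d are the images of the four vertices that φ may move.
  rigid-table : ∀ p q a → (∀ y → Adj p y → Adj (nonAdjX₁ q) y → Adj a y) →
                ∀ b → (∀ y → Adj p y → Adj (nonAdjX₂ q) y → Adj b y) →
                ∀ c → (∀ x → Adj x q → Adj x (nonAdjY₁ p) → Adj x c) →
                (Adj (nonAdjX₁ q) (nonAdjY₁ p) → Adj a c) →
                (Adj (nonAdjX₂ q) (nonAdjY₁ p) → Adj b c) →
                ∀ d → (∀ x → Adj x q → Adj x (nonAdjY₂ p) → Adj x d) →
                (Adj (nonAdjX₁ q) (nonAdjY₂ p) → Adj a d) →
                (Adj (nonAdjX₂ q) (nonAdjY₂ p) → Adj b d) →
                ((a ≡ nonAdjX₁ q × b ≡ nonAdjX₂ q) × (c ≡ nonAdjY₁ p × d ≡ nonAdjY₂ p)) ⊎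
                ((a ≢ nonAdjX₁ q × b ≢ nonAdjX₂ q) × (c ≢ nonAdjY₁ p × d ≢ nonAdjY₂ p))
  rigid-table = toWitness {a? = all? λ p → all? λ q → all? λ a →
    (all? λ y → adj? p y →-dec adj? (nonAdjX₁ q) y →-dec adj? a y) →-dec all? λ b →
    (all? λ y → adj? p y →-dec adj? (nonAdjX₂ q) y →-dec adj? b y) →-dec all? λ c →
    (all? λ x → adj? x q →-dec adj? x (nonAdjY₁ p) →-dec adj? x c) →-dec
    (adj? (nonAdjX₁ q) (nonAdjY₁ p) →-dec adj? a c) →-dec
    (adj? (nonAdjX₂ q) (nonAdjY₁ p) →-dec adj? b c) →-dec all? λ d →
    (all? λ x → adj? x q →-dec adj? x (nonAdjY₂ p) →-dec adj? x d) →-dec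
    (adj? (nonAdjX₁ q) (nonAdjY₂ p) →-dec adj? a d) →-dec
    (adj? (nonAdjX₂ q) (nonAdjY₂ p) →-dec adj? b d) →-dec
    ((((a ≟ nonAdjX₁ q) ×-dec (b ≟ nonAdjX₂ q)) ×-dec ((c ≟ nonAdjY₁ p) ×-dec (d ≟ nonAdjY₂ p)))
    ⊎-dec
    ((¬? (a ≟ nonAdjX₁ q) ×-dec ¬? (b ≟ nonAdjX₂ q)) ×-dec
     (¬? (c ≟ nonAdjY₁ p) ×-dec ¬? (d ≟ nonAdjY₂ p))))} _

module _ (φ : K ⟶ K) where

  MovedX MovedY : Fin 6 → Set
  MovedX x = onX φ x ≢ x
  MovedY y = onY φ y ≢ y

  -- Only the two non-neighbours of `q` and the two of `p` have undetermined images; enumerating the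
  -- images that preserve edges shows that all four are fixed or all four are moved.
  rigid : ∀ p q → (∀ y → Adj p y → onY φ y ≡ y) → (∀ x → Adj x q → onX φ x ≡ x) →
          IsIdentity φ ⊎
          ((MovedX (nonAdjX₁ q) × MovedX (nonAdjX₂ q)) ×
           (MovedY (nonAdjY₁ p) × MovedY (nonAdjY₂ p)))
  rigid p q fixNp fixNq
    with rigid-table p q
           _ (fromX (nonAdjX₁ q)) _ (fromX (nonAdjX₂ q))
           -- `fromX` and `fromY` handle edges with one end known to be fixed; `onE φ` handles those
           -- with both ends undetermined.
           _ (fromY (nonAdjY₁ p)) (onE φ) (onE φ)
           _ (fromY (nonAdjY₂ p)) (onE φ) (onE φ)
    where
    fromX : ∀ x y → Adj p y → Adj x y → Adj (onX φ x) y
    fromX x y py xy = subst (Adj (onX φ x)) (fixNp y py) (onE φ xy)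
    fromY : ∀ y x → Adj x q → Adj x y → Adj x (onY φ y)
    fromY y x xq xy = subst (λ z → Adj z (onY φ y)) (fixNq x xq) (onE φ xy)
  ... | inj₂ moved = inj₂ moved
  ... | inj₁ ((a , b) , (c , d)) = inj₁ (isId fixesX fixesY)
    where
    fixesX : ∀ x → onX φ x ≡ x
    fixesX x with splitX q x
    ... | inj₁ xq          = fixNq x xq
    ... | inj₂ (inj₁ refl) = a
    ... | inj₂ (inj₂ refl) = b
    fixesY : ∀ y → onY φ y ≡ y
    fixesY y with splitY p y
    ... | inj₁ py          = fixNp y py
    ... | inj₂ (inj₁ refl) = c
    ... | inj₂ (inj₂ refl) = d

  -- If one side is fixed pointwise, the image of a vertex on the other side is adjacent to all
  -- neighbours of that vertex, hence equals it by incomparability.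
  identity-or-moves : IsIdentity φ ⊎ ∃ MovedX × ∃ MovedY
  identity-or-moves
    with all? (λ x → onX φ x ≟ x) | all? (λ y → onY φ y ≟ y)
  ... | yes fx | _ = inj₁ (isId fx λ y → incomparableY y (onY φ y)
          λ x xy → subst (λ z → Adj z (onY φ y)) (fx x) (onE φ xy))
  ... | no _ | yes fy = inj₁ (isId (λ x → incomparableX x (onX φ x)
          λ y xy → subst (Adj (onX φ x)) (fy y) (onE φ xy)) fy)
  ... | no mx | no my = inj₂
          (¬∀⟶∃¬ 6 _ (λ x → onX φ x ≟ x) mx , ¬∀⟶∃¬ 6 _ (λ y → onY φ y ≟ y) my)

complementary-endomorphisms :
  (φ χ : K ⟶ K) →
  (∀ x y → Adj x y → onX φ x ≡ x ⊎ onY χ y ≡ y) →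
  (∀ x y → Adj x y → onX χ x ≡ x ⊎ onY φ y ≡ y) →
  IsIdentity φ ⊎ IsIdentity χ
complementary-endomorphisms φ χ φχ χφ with identity-or-moves φ | identity-or-moves χ
... | inj₁ φ-id | _ = inj₁ φ-id
... | inj₂ _ | inj₁ χ-id = inj₂ χ-id
... | inj₂ ((_ , _) , (q′ , mq′)) | inj₂ ((p , mp) , (q , mq))
  -- `χ` moves `p` and `q`, so `φ` fixes all their neighbours.
  with rigid φ p q (λ y py → fromInj₂ (⊥-elim ∘ mp) (χφ p y py))
                   (λ x xq → fromInj₁ (⊥-elim ∘ mq) (φχ x q xq))
... | inj₁ φ-id = inj₁ φ-id
... | inj₂ ((m₁ , m₂) , _)
  -- The roles are exchanged: `φ` moves `nonAdjX₁ q` and `q′`, so `χ` fixes all their neighbours.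
  with rigid χ (nonAdjX₁ q) q′
         (λ y xy → fromInj₂ (⊥-elim ∘ m₁) (φχ _ y xy))
         (λ x xy → fromInj₁ (⊥-elim ∘ mq′) (χφ x q′ xy))
... | inj₁ χ-id = inj₂ χ-id
-- The second non-neighbour of `nonAdjX₁ q` is `q` itself; the first is adjacent to `nonAdjX₂ q`,
-- which `φ` moves, so `χ` has to fix it.
... | inj₂ (_ , (m₃ , _)) =
  contradiction (fromInj₂ (⊥-elim ∘ m₂) (φχ _ _ (nonAdjX₂-adj-nonAdjY₁ q))) m₃

-- Induction on the construction.

¬K-retract-singleEdge : ¬ (K isRetractOf singleEdge)
-- The even vertices 0 and 2 have the same image in the one-vertex side, so no retraction can
-- separate them.
¬K-retract-singleEdge (retract _ r (isId rx _)) with () ← trans (sym (rx 0F)) (rx 1F)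

module _ {G : BipGraph} (oldX : X G → Bool) (oldY : Y G → Bool) where

  -- Both endomorphisms pass through `G` after folding, so whichever is the identity splits there
  -- into a section and a retraction.
  K-retract-double : K isRetractOf double G oldX oldY → K isRetractOf G
  K-retract-double (retract i r (isId rx ry))
    with complementary-endomorphisms
           (through (original oldX oldY)) (through (copied oldX oldY))
           (λ x y xy → transport (edge-fixedˡ oldX oldY _ _ (onE i xy)))
           (λ x y xy → transport (edge-fixedʳ oldX oldY _ _ (onE i xy)))
    where
    through : G ⟶ double G oldX oldY → K ⟶ K
    through c = r ⊙ c ⊙ folding oldX oldY ⊙ i
    transport : ∀ {x y u v} →
                u ≡ onX i x ⊎ v ≡ onY i y → onX r u ≡ x ⊎ onY r v ≡ y
    transport (inj₁ p) = inj₁ (trans (cong (onX r) p) (rx _))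
    transport (inj₂ p) = inj₂ (trans (cong (onY r) p) (ry _))
  ... | inj₁ φ-id = retract (folding oldX oldY ⊙ i) (r ⊙ original oldX oldY) φ-id
  ... | inj₂ χ-id = retract (folding oldX oldY ⊙ i) (r ⊙ copied oldX oldY) χ-id

¬K-retract-constructible : ∀ {G} → Constructible G → ¬ (K isRetractOf G)
¬K-retract-constructible edge ret = ¬K-retract-singleEdge ret
¬K-retract-constructible (doubling oldX oldY c) ret =
  ¬K-retract-constructible c (K-retract-double oldX oldY ret)
¬K-retract-constructible (collapse _ _ c ρ) ret =
  ¬K-retract-constructible c (retract-trans ret (induced-retract ρ))
¬K-retract-constructible (rename c iso) ret =
  ¬K-retract-constructible c (retract-trans ret (≅⇒retract iso))

theorem8p2 : ¬ Constructible C12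
theorem8p2 c = ¬K-retract-constructible c K-retract-C12
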